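{- $\mathfrak{s} = \mathfrak{s}_{\omega,\omega}$.
   Context: $\mathcal{P}(\omega)$ is the power set of $\omega$ and $[\omega]^{\omega}$ is the set of infinite subsets of $\omega$. For $x \subset \omega$, write $x^0 = x$ and $x^1 = \omega \setminus x$. For $x, a \in \mathcal{P}(\omega)$, $x$ splits $a$ if $|x^0 \cap a| = |x^1 \cap a| = \omega$. A family $\mathcal{F} \subset \mathcal{P}(\omega)$ is a splitting family if for every $a \in [\omega]^{\omega}$ there is $x \in \mathcal{F}$ such that $x$ splits $a$. A family $\mathcal{F} \subset \mathcal{P}(\omega)$ is $(\omega,\omega)$-splitting if for each countable collection $\{a_n : n \in \omega\} \subset [\omega]^{\omega}$ there exists $x \in \mathcal{F}$ such that there are infinitely many $n \in \omega$ with $|x^0 \cap a_n| = \omega$ and there are infinitely many $n \in \omega$ with $|x^1 \cap a_n| = \omega$. Define $$\mathfrak{s} = \min\{|\mathcal{F}| : \mathcal{F} \subset \mathcal{P}(\omega) \text{ is a splitting family}\},$$ $$\mathfrak{s}_{\omega,\omega} = \min\{|\mathcal{F}| : \mathcal{F} \subset \mathcal{P}(\omega) \text{ is } (\omega,\omega)\text{ -splitting}\}.$$ The ambient theory is ZFC. -}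

module Defs where

open import Data.Nat using (ℕ)
open import Data.Product using (Σ; ∃; _×_; proj₁)
open import Function.Bundles using (Func; Injection; Bijection)
open import Level using (Level; 0ℓ; suc; _⊔_)
open import Relation.Binary using (Setoid; REL; _Respectsˡ_; _Respectsʳ_)
import Relation.Binary.Construct.On as On
import Relation.Binary.PropositionalEquality as ≡
open import Relation.Unary using (Pred; _∈_; _∩_; ∁)
open import Relation.Unary.Relation.Binary.Equality using (≐-setoid)

-- Setoids play the role of sets.  `∃` already carries a witness, so the
-- content of choice is that the witness can be picked independently of
-- the representative: the chosen function must preserve `_≈_`.

AxiomOfChoice : (a ℓ₁ b ℓ₂ r : Level) → Set (suc (a ⊔ ℓ₁ ⊔ b ⊔ ℓ₂ ⊔ r))
AxiomOfChoice a ℓ₁ b ℓ₂ r =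
  (A : Setoid a ℓ₁) (B : Setoid b ℓ₂) →
  let module A = Setoid A
      module B = Setoid B in
  (R : REL A.Carrier B.Carrier r) →
  R Respectsˡ A._≈_ → R Respectsʳ B._≈_ →
  (∀ x → ∃ λ y → R x y) →
  Σ (Func A B) λ f → ∀ x → R x (Func.to f x)

private
  variable
    a b p ℓ₁ ℓ₂ : Level

infix 4 _≈ᶜ_ _≤ᶜ_

_≈ᶜ_ : Setoid a ℓ₁ → Setoid b ℓ₂ → Set _
A ≈ᶜ B = Bijection A B

_≤ᶜ_ : Setoid a ℓ₁ → Setoid b ℓ₂ → Set _
A ≤ᶜ B = Injection A B

-- Membership proofs are ignored, and P need not respect the equality of
-- S: the result is always the image of P in the quotient of S.

subset : (S : Setoid a ℓ₁) → Pred (Setoid.Carrier S) p → Setoid (a ⊔ p) ℓ₁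
subset S P = On.setoid {B = Σ (Setoid.Carrier S) P} S proj₁

Subset : Set₁
Subset = Pred ℕ 0ℓ

Infinite : Pred Subset 0ℓ
Infinite A = subset (≡.setoid ℕ) A ≈ᶜ ≡.setoid ℕ

Family : Set₂
Family = Pred Subset (suc 0ℓ)

∣_∣ : Family → Setoid (suc 0ℓ) 0ℓ
∣ F ∣ = subset (≐-setoid ℕ 0ℓ) F

_Splits_ : Subset → Subset → Set
x Splits a = Infinite (x ∩ a) × Infinite (∁ x ∩ a)

SplittingFamily : Pred Family (suc 0ℓ)
SplittingFamily F = ∀ a → Infinite a → ∃ λ x → x ∈ F × x Splits a

[ω,ω]-Splitting : Pred Family (suc 0ℓ)
[ω,ω]-Splitting F =
  (a : ℕ → Subset) → (∀ n → Infinite (a n)) →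
  ∃ λ x → x ∈ F
        × Infinite (λ n → Infinite (x ∩ a n))
        × Infinite (λ n → Infinite (∁ x ∩ a n))

-- Cardinals are setoids considered up to `_≈ᶜ_`, so a minimum of
-- cardinalities is a property that determines κ up to `_≈ᶜ_`.

_IsMinCardinalityOf_ : Setoid (suc 0ℓ) 0ℓ → Pred Family (suc 0ℓ) → Set₂
κ IsMinCardinalityOf P =
  (∃ λ F → P F × κ ≈ᶜ ∣ F ∣) × (∀ F → P F → κ ≤ᶜ ∣ F ∣)

Is-𝔰 : Pred (Setoid (suc 0ℓ) 0ℓ) (suc (suc 0ℓ))
Is-𝔰 κ = κ IsMinCardinalityOf SplittingFamily

Is-𝔰[ω,ω] : Pred (Setoid (suc 0ℓ) 0ℓ) (suc (suc 0ℓ))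
Is-𝔰[ω,ω] κ = κ IsMinCardinalityOf [ω,ω]-Splitting

{-# OPTIONS --safe #-}
module Submission where

-- An (ω,ω)-splitting family splits a, as one sees from the constant sequence a.
-- Conversely let F be splitting but fail to be (ω,ω)-splitting at (aₙ).  For
-- x ∈ F, one of x, ω ∖ x has finite intersection with almost every aₙ, and the
-- points from which these intersections are empty give functions hₓ.  If some g
-- bounded all hₓ, a set of points of aₙ beyond g(n) would be unsplit by F; so
-- {hₓ} is unbounded.  Cut ω into intervals by iterating hₓ: given infinite sets
-- cₙ, for some x infinitely many intervals k meet each of c₀, …, c_k, and a y ∈ F
-- splitting the set of these k yields a union of intervals which splits every cₙ.
-- There are |F × F| such unions, and |F × F| = |F| as F is infinite.

open import Defs
open import Axiom.ExcludedMiddle using (ExcludedMiddle)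
open import Data.Bool using (Bool; true; false; T; if_then_else_)
open import Data.Bool.Properties using (T-irrelevant)
open import Data.Empty using (⊥; ⊥-elim)
open import Data.Unit using (⊤)
open import Data.List as List using (List; []; _∷_)
open import Data.List.Relation.Unary.All as All using (All; []; _∷_)
open import Data.List.Relation.Unary.Any using (here; there)
import Data.List.Relation.Unary.All.Properties as All
import Data.List.Membership.Propositional as List
open import Data.Maybe using (Maybe; just; nothing)
open import Data.Maybe.Properties using (just-injective)
open import Data.Nat using (ℕ; zero; suc; _+_; _*_; _≤_; _<_; _≤?_; z≤n; s≤s)
open import Data.Nat.Properties
import Data.Fin as Fin
import Data.Fin.Properties as Fin
open import Data.Product using (Σ; ∃; _×_; _,_; proj₁; proj₂; map; map₁; map₂)
open import Data.Product.Relation.Binary.Pointwise.NonDependent using (×-setoid)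
open import Data.Sum using (_⊎_; inj₁; inj₂; [_,_]′)
open import Function using (_∘_; id)
open import Function.Bundles using (Func; Injection; Inverse)
import Function.Construct.Composition as Comp
import Function.Construct.Identity as Identity
import Function.Construct.Symmetry as Symmetry
import Function.Properties.Bijection as Bij
import Function.Properties.Inverse as Inv
open import Level using (Level; Lift; 0ℓ; _⊔_) renaming (suc to lsuc)
open import Relation.Binary using (Setoid; Rel; Symmetric; Reflexive; tri<; tri≈; tri>)
open import Relation.Binary.PropositionalEquality as ≡
  using (_≡_; _≢_; refl; sym; trans; cong; cong₂; subst; _≗_; _→-setoid_)
open import Relation.Nullary using (¬_; Dec; yes; no; contradiction)
open import Relation.Nullary.Decidable using (toWitness; fromWitness; decidable-stable; isYes)
open import Relation.Unary using (Pred; _∈_; _⊆_; _∩_; ∁; _≐_; U)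
open import Relation.Unary.Properties using (≐-refl; ≐-sym; ≐-trans)
open import Relation.Unary.Relation.Binary.Equality using (≐-setoid)

private
  variable
    a b c ℓ ℓ₁ ℓ₂ ℓ₃ : Level

-- Comparison of cardinalities, and a pairing function on ω.

≤ᶜ-trans : {A : Setoid a ℓ₁} {B : Setoid b ℓ₂} {C : Setoid c ℓ₃} →
           A ≤ᶜ B → B ≤ᶜ C → A ≤ᶜ C
≤ᶜ-trans = Comp.injection

≈ᶜ⇒≥ᶜ : {A : Setoid a ℓ₁} {B : Setoid b ℓ₂} → A ≈ᶜ B → B ≤ᶜ A
≈ᶜ⇒≥ᶜ f = Inv.Inverse⇒Injection (Symmetry.inverse (Bij.Bijection⇒Inverse f))

-- Each term of the sequence is taken fresh for the list of all earlier terms, so any two terms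
-- differ.
fresh⇒ℕ≤ᶜ : (S : Setoid a ℓ) →
            (∀ xs → ∃ λ x → All (λ y → ¬ Setoid._≈_ S x y) xs) →
            ≡.setoid ℕ ≤ᶜ S
fresh⇒ℕ≤ᶜ S fresh = record
  { to        = term
  ; cong      = λ { refl → Setoid.refl S }
  ; injective = injective
  }
  where
  open Setoid S using (Carrier; _≈_)

  prefix : ℕ → List Carrier
  prefix zero    = []
  prefix (suc n) = proj₁ (fresh (prefix n)) ∷ prefix n

  term : ℕ → Carrier
  term n = proj₁ (fresh (prefix n))

  term∈prefix : ∀ {m n} → m < n → term m List.∈ prefix n
  term∈prefix {n = suc n} (s≤s m≤n) with m≤n⇒m<n∨m≡n m≤n
  ... | inj₁ m<n  = there (term∈prefix m<n)
  ... | inj₂ refl = here refl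

  distinct : ∀ {m n} → m < n → ¬ term n ≈ term m
  distinct {n = n} m<n = All.lookup (proj₂ (fresh (prefix n))) (term∈prefix m<n)

  injective : ∀ {m n} → term m ≈ term n → m ≡ n
  injective {m} {n} eq with <-cmp m n
  ... | tri< m<n _ _ = contradiction (Setoid.sym S eq) (distinct m<n)
  ... | tri≈ _ m≡n _ = m≡n
  ... | tri> _ _ n<m = contradiction eq (distinct n<m)

-- (m + n)² + m lies in [k², (k + 1)²) for k = m + n.

pairℕ : ℕ → ℕ → ℕ
pairℕ m n = (m + n) * (m + n) + m

pairℕ-mono-< : ∀ {m n m′ n′} → m + n < m′ + n′ → pairℕ m n < pairℕ m′ n′
pairℕ-mono-< {m} {n} {m′} {n′} k<k′ = begin-strict
  k * k + m        ≤⟨ +-monoʳ-≤ (k * k) (m≤m+n m n) ⟩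
  k * k + k        ≡⟨ +-comm (k * k) k ⟩
  suc k * k        <⟨ *-monoʳ-< (suc k) (n<1+n k) ⟩
  suc k * suc k    ≤⟨ *-mono-≤ k<k′ k<k′ ⟩
  k′ * k′          ≤⟨ m≤m+n (k′ * k′) m′ ⟩
  k′ * k′ + m′     ∎
  where
  open ≤-Reasoning
  k  = m + n
  k′ = m′ + n′

pairℕ-injective : ∀ {m n m′ n′} → pairℕ m n ≡ pairℕ m′ n′ → m ≡ m′ × n ≡ n′
pairℕ-injective {m} {n} {m′} {n′} eq with <-cmp (m + n) (m′ + n′)
... | tri< k<k′ _ _ = contradiction eq (<⇒≢ (pairℕ-mono-< {m} {n} {m′} {n′} k<k′))
... | tri> _ _ k′<k = contradiction (sym eq) (<⇒≢ (pairℕ-mono-< {m′} {n′} {m} {n} k′<k))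
... | tri≈ _ k≡k′ _
  with refl ← +-cancelˡ-≡ ((m + n) * (m + n)) m m′
                (trans eq (cong (λ k → k * k + m′) (sym k≡k′)))
  = refl , +-cancelˡ-≡ m n n′ k≡k′

-- Interval partitions of ω.

cumulative : (ℕ → ℕ) → ℕ → ℕ
cumulative f zero    = f zero
cumulative f (suc n) = cumulative f n + f (suc n)

cumulative-upper : ∀ f {i n} → i ≤ n → f i ≤ cumulative f n
cumulative-upper f {zero}  {zero}  _ = ≤-refl
cumulative-upper f {i}     {suc n} i≤ with m≤n⇒m<n∨m≡n i≤
... | inj₁ (s≤s i≤n) = ≤-trans (cumulative-upper f i≤n) (m≤m+n _ _)
... | inj₂ refl      = m≤n+m _ _

cumulative-mono : ∀ f {m n} → m ≤ n → cumulative f m ≤ cumulative f n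
cumulative-mono f {n = zero}  z≤n = ≤-refl
cumulative-mono f {n = suc n} m≤ with m≤n⇒m<n∨m≡n m≤
... | inj₁ (s≤s m≤n) = ≤-trans (cumulative-mono f m≤n) (m≤m+n _ _)
... | inj₂ refl      = ≤-refl

module Blocks (h : ℕ → ℕ) where

  -- The successor and the summand `n` make `reach n` exceed `n`, so that blocks are nonempty;
  -- partial sums make it monotone although `h` need not be.
  reach : ℕ → ℕ
  reach n = suc (n + cumulative h n)

  reach-upper : ∀ n → h n ≤ reach n
  reach-upper n = ≤-trans (cumulative-upper h ≤-refl) (≤-trans (m≤n+m _ n) (n≤1+n _))

  reach-mono : ∀ {m n} → m ≤ n → reach m ≤ reach n
  reach-mono m≤n = s≤s (+-mono-≤ m≤n (cumulative-mono h m≤n))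

  -- Block k is the interval [start k , start (suc k)).

  start : ℕ → ℕ
  start zero    = zero
  start (suc k) = reach (start k)

  start-step : ∀ k → start k < start (suc k)
  start-step k = s≤s (m≤m+n _ _)

  start-mono : ∀ {k l} → k ≤ l → start k ≤ start l
  start-mono {l = zero}  z≤n = z≤n
  start-mono {l = suc l} k≤ with m≤n⇒m<n∨m≡n k≤
  ... | inj₁ (s≤s k≤l) = ≤-trans (start-mono k≤l) (<⇒≤ (start-step l))
  ... | inj₂ refl      = ≤-refl

  k≤start : ∀ k → k ≤ start k
  k≤start zero    = z≤n
  k≤start (suc k) = ≤-<-trans (k≤start k) (start-step k)

  locate : ∀ m → ∃ λ k → start k ≤ m × m < start (suc k)
  locate zero = 0 , z≤n , s≤s z≤n
  locate (suc m) with locate m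
  ... | k , lo , hi with start (suc k) ≤? suc m
  -- By `hi`, `suc m` is at most the start of the next block, hence here equal to it.
  ...   | yes start≤ = suc k , start≤ , ≤-<-trans hi (start-step (suc k))
  ...   | no  start≰ = k , m≤n⇒m≤1+n lo , ≰⇒> start≰

  block : ℕ → ℕ
  block m = proj₁ (locate m)

  start-block : ∀ m → start (block m) ≤ m
  start-block m = proj₁ (proj₂ (locate m))

  block-end : ∀ m → m < start (suc (block m))
  block-end m = proj₂ (proj₂ (locate m))

  block≤ : ∀ m → block m ≤ m
  block≤ m = ≤-trans (k≤start _) (start-block m)

  start≤⇒≤block : ∀ {k m} → start k ≤ m → k ≤ block m
  start≤⇒≤block {k} {m} start≤m = ≮⇒≥ λ block<k →
    <⇒≱ (block-end m) (≤-trans (start-mono block<k) start≤m)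

  block-unique : ∀ {k m} → start k ≤ m → m < start (suc k) → block m ≡ k
  block-unique {k} {m} lo hi = ≤-antisym
    (≮⇒≥ λ k<block → <⇒≱ hi (≤-trans (start-mono k<block) (start-block m)))
    (start≤⇒≤block lo)

module Classical
  (em : ∀ {ℓ} → ExcludedMiddle ℓ)
  (ac : ∀ {a ℓ₁ b ℓ₂ r} → AxiomOfChoice a ℓ₁ b ℓ₂ r)
  where

  -- Excluded middle, Boolean truth values, canonical representatives.

  dec : (P : Set ℓ) → Dec P
  dec P = em

  ¬∀⇒∃¬ : {A : Set a} {P : Pred A ℓ} → ¬ (∀ x → P x) → ∃ λ x → ¬ P x
  ¬∀⇒∃¬ {P = P} ¬∀ with dec (∃ λ x → ¬ P x)
  ... | yes p = p
  ... | no ¬∃ = contradiction (λ x → decidable-stable em (λ ¬p → ¬∃ (x , ¬p))) ¬∀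

  -- Truth values are Boolean, which makes subsets impredicative: a union may
  -- range over subsets of any universe without raising its own level.

  abstract
    ⌊_⌋ : Set ℓ → Bool
    ⌊ P ⌋ = isYes (dec P)

    ⌊⌋-intro : {P : Set ℓ} → P → T ⌊ P ⌋
    ⌊⌋-intro {P = P} = fromWitness {a? = dec P}

    ⌊⌋-elim : {P : Set ℓ} → T ⌊ P ⌋ → P
    ⌊⌋-elim {P = P} = toWitness {a? = dec P}

  -- Choice for `_≈_` itself, taken from `S` to its carrier under `_≡_`, selects representatives:
  -- equivalent elements receive identical ones.
  module Canonical (S : Setoid a ℓ) where
    open Setoid S using (Carrier; _≈_)

    private
      choice : Σ (Func S (≡.setoid Carrier)) λ f → ∀ x → x ≈ Func.to f x
      choice = ac S (≡.setoid Carrier) _≈_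
        (λ x≈y x≈z → Setoid.trans S (Setoid.sym S x≈y) x≈z)
        (λ { refl x≈y → x≈y })
        (λ x → x , Setoid.refl S)

    canonical : Carrier → Carrier
    canonical = Func.to (proj₁ choice)

    canonical-cong : ∀ {x y} → x ≈ y → canonical x ≡ canonical y
    canonical-cong = Func.cong (proj₁ choice)

    ≈-canonical : ∀ x → x ≈ canonical x
    ≈-canonical = proj₂ choice

    canonical-injective : ∀ {x y} → canonical x ≡ canonical y → x ≈ y
    canonical-injective {x} {y} eq =
      Setoid.trans S (≈-canonical x)
        (subst (_≈ y) (sym eq) (Setoid.sym S (≈-canonical y)))

  -- The Cantor-Schröder-Bernstein theorem.

  module CantorSchröderBernstein
    {A : Setoid a ℓ₁} {B : Setoid b ℓ₂} (f : A ≤ᶜ B) (g : B ≤ᶜ A) where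

    private
      module A = Setoid A
      module B = Setoid B
      module f = Injection f
      module g = Injection g

    -- Points whose chain of preimages stops in `A`, outside the range of `g`. The bijection follows
    -- `f` on them and the inverse of `g` elsewhere.
    data Orphaned : A.Carrier → Set (a ⊔ b ⊔ ℓ₁) where
      root : ∀ {x} → (∀ y → ¬ g.to y A.≈ x) → Orphaned x
      step : ∀ {x z} → Orphaned x → g.to (f.to x) A.≈ z → Orphaned z

    Orphaned-resp : ∀ {x y} → x A.≈ y → Orphaned x → Orphaned y
    Orphaned-resp x≈y (root ∉g)   = root λ z gz≈y → ∉g z (A.trans gz≈y (A.sym x≈y))
    Orphaned-resp x≈y (step o eq) = step o (A.trans eq x≈y)

    Match : A.Carrier → B.Carrier → Set _
    Match x y = (Orphaned x × y B.≈ f.to x) ⊎ (¬ Orphaned x × g.to y A.≈ x)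

    match : ∀ x → ∃ (Match x)
    match x with dec (Orphaned x) | dec (∃ λ y → g.to y A.≈ x)
    ... | yes o | _            = f.to x , inj₁ (o , B.refl)
    ... | no ¬o | yes (y , eq) = y , inj₂ (¬o , eq)
    ... | no ¬o | no ∉g        = contradiction (root (λ y eq → ∉g (y , eq))) ¬o

    Match-functional : ∀ {x x′ y y′} → Match x y → Match x′ y′ → x A.≈ x′ → y B.≈ y′
    Match-functional (inj₁ (o , p)) (inj₁ (o′ , p′)) e = B.trans p (B.trans (f.cong e) (B.sym p′))
    Match-functional (inj₁ (o , _)) (inj₂ (¬o , _)) e = contradiction (Orphaned-resp e o) ¬o
    Match-functional (inj₂ (¬o , _)) (inj₁ (o , _)) e = contradiction (Orphaned-resp (A.sym e) o) ¬o
    Match-functional (inj₂ (_ , p)) (inj₂ (_ , p′)) e = g.injective (A.trans p (A.trans e (A.sym p′)))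

    Match-injective : ∀ {x x′ y y′} → Match x y → Match x′ y′ → y B.≈ y′ → x A.≈ x′
    Match-injective (inj₁ (o , p)) (inj₁ (o′ , p′)) e =
      f.injective (B.trans (B.sym p) (B.trans e p′))
    Match-injective (inj₁ (o , p)) (inj₂ (¬o , p′)) e =
      contradiction (step o (A.trans (g.cong (B.trans (B.sym p) e)) p′)) ¬o
    Match-injective (inj₂ (¬o , p)) (inj₁ (o , p′)) e =
      contradiction (step o (A.trans (g.cong (B.trans (B.sym p′) (B.sym e))) p)) ¬o
    Match-injective (inj₂ (_ , p)) (inj₂ (_ , p′)) e =
      A.trans (A.sym p) (A.trans (g.cong e) p′)

    -- If `g.to y` is not orphaned, it is matched with `y`. Otherwise it is no root, so it is the
    -- image under `g` of some `f.to x` with `x` orphaned, and `y` is that `f.to x`.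
    Match-surjective : ∀ y → ∃ λ x → Match x y
    Match-surjective y with dec (Orphaned (g.to y))
    ... | no ¬o           = g.to y , inj₂ (¬o , A.refl)
    ... | yes (root ∉g)   = contradiction A.refl (∉g y)
    ... | yes (step {x} o eq) = x , inj₁ (o , B.sym (g.injective eq))

    ≤ᶜ-antisym : A ≈ᶜ B
    ≤ᶜ-antisym = record
      { to        = λ x → proj₁ (match x)
      ; cong      = λ {x} {x′} → Match-functional (proj₂ (match x)) (proj₂ (match x′))
      ; bijective =
          (λ {x} {x′} → Match-injective (proj₂ (match x)) (proj₂ (match x′))) ,
          (λ y → let (x , m) = Match-surjective y in
            x , λ {z} → Match-functional (proj₂ (match z)) m)
      }

  open CantorSchröderBernstein using (≤ᶜ-antisym)

  -- Maximal cliques by Zermelo's method.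

  module MaximalClique {A : Set a} (_~_ : Rel A ℓ)
                       (~-refl : Reflexive _~_) (~-sym : Symmetric _~_) where

    Sub : Set a
    Sub = A → Bool

    infix 4 _⊑_

    _⊑_ : Rel Sub a
    S ⊑ R = ∀ {x} → T (S x) → T (R x)

    ⊑-antisym : ∀ {S R} → S ⊑ R → R ⊑ S → S ≗ R
    ⊑-antisym {S} {R} S⊑R R⊑S x with S x | R x | S⊑R {x} | R⊑S {x}
    ... | true  | true  | _ | _ = refl
    ... | false | false | _ | _ = refl
    ... | true  | false | p | _ = ⊥-elim (p _)
    ... | false | true  | _ | p = ⊥-elim (p _)

    Clique : Sub → Set (a ⊔ ℓ)
    Clique S = ∀ {x y} → T (S x) → T (S y) → x ~ y

    Extends : A → Sub → Set (a ⊔ ℓ)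
    Extends x S = ¬ T (S x) × (∀ {y} → T (S y) → x ~ y)

    private
      module Subs = Canonical (A →-setoid Bool)

      candidate : Sub → Maybe A
      candidate S with dec (∃ λ x → Extends x S)
      ... | yes (x , _) = just x
      ... | no _        = nothing

      candidate-extends : ∀ S {x} → candidate S ≡ just x → Extends x S
      candidate-extends S eq with dec (∃ λ x → Extends x S)
      candidate-extends S refl | yes (_ , ext) = ext

      candidate-exists : ∀ S {x} → Extends x S → ∃ λ y → candidate S ≡ just y
      candidate-exists S {x} ext with dec (∃ λ x → Extends x S)
      ... | yes (y , _) = y , refl
      ... | no ¬ext     = contradiction (x , ext) ¬ext

      Extends-resp : ∀ {x S R} → S ≗ R → Extends x S → Extends x R
      Extends-resp {x} S≗R (x∉S , x~) =
        (λ x∈R → x∉S (subst T (sym (S≗R x)) x∈R)) ,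
        (λ {y} y∈R → x~ (subst T (sym (S≗R y)) y∈R))

    -- Choosing at the canonical copy makes the new point depend only on the extension of `S`, so
    -- pointwise equal sets have the same successor.
    pick : Sub → Maybe A
    pick S = candidate (Subs.canonical S)

    pick-extends : ∀ S {x} → pick S ≡ just x → Extends x S
    pick-extends S eq = Extends-resp (λ x → sym (Subs.≈-canonical S x)) (candidate-extends _ eq)

    pick-exists : ∀ S {x} → Extends x S → ∃ λ y → pick S ≡ just y
    pick-exists S ext = candidate-exists _ (Extends-resp (Subs.≈-canonical S) ext)

    next : Sub → Sub
    next S x = ⌊ T (S x) ⊎ pick S ≡ just x ⌋

    ⊑-next : ∀ {S} → S ⊑ next S
    ⊑-next x∈S = ⌊⌋-intro (inj₁ x∈S)

    ⋃ : (Sub → Bool) → Sub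
    ⋃ P x = ⌊ (∃ λ S → T (P S) × T (S x)) ⌋

    -- Zermelo's tower: its linearity takes the place of a well-ordering of A.

    data Tower : Sub → Set a where
      succ  : ∀ {S} → Tower S → Tower (next S)
      union : ∀ P → (∀ S → T (P S) → Tower S) → Tower (⋃ P)

    Comparable : Sub → Set a
    Comparable C = ∀ {R} → Tower R → R ⊑ C ⊎ C ⊑ R

    -- Induction on `R`; the critical case is a successor with `R ⊑ C`. If also `C ⊑ R`, both sets
    -- have the same successor. Otherwise `C` has a point outside `R`; should `C ⊑ next R`, this is
    -- the only point that `next` adds, so `next R ⊑ C`.
    next-comparable : ∀ {C} → Comparable C → ∀ {R} → Tower R → R ⊑ C ⊎ next C ⊑ R
    next-comparable {C} comp (succ {R} r) with next-comparable comp r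
    ... | inj₂ nC⊑R = inj₂ (λ p → ⊑-next (nC⊑R p))
    ... | inj₁ R⊑C with dec (∃ λ x → T (C x) × ¬ T (R x))
    ...   | no none = inj₂ (λ {x} p → ⌊⌋-intro
              ([ (λ x∈C → inj₁ (C⊑R x∈C))
               , (λ eq → inj₂ (trans (cong candidate (Subs.canonical-cong (⊑-antisym R⊑C C⊑R))) eq))
               ]′ (⌊⌋-elim p)))
      where
      C⊑R : C ⊑ R
      C⊑R {x} x∈C = decidable-stable em λ x∉R → none (x , x∈C , x∉R)
    ...   | yes (x , x∈C , x∉R) with comp (succ r)
    ...     | inj₁ nR⊑C = inj₁ nR⊑C
    ...     | inj₂ C⊑nR with ⌊⌋-elim {P = T (R x) ⊎ pick R ≡ just x} (C⊑nR x∈C)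
    ...       | inj₁ x∈R = contradiction x∈R x∉R
    ...       | inj₂ px = inj₁ λ p →
                  [ R⊑C
                  , (λ py → subst (T ∘ C) (just-injective (trans (sym px) py)) x∈C)
                  ]′ (⌊⌋-elim p)
    next-comparable {C} comp (union P towers) with dec (∃ λ S → T (P S) × next C ⊑ S)
    ... | yes (S , S∈P , nC⊑S) = inj₂ λ p → ⌊⌋-intro (S , S∈P , nC⊑S p)
    ... | no none = inj₁ λ p → let (S , S∈P , x∈S) = ⌊⌋-elim p in
          [ (λ S⊑C → S⊑C x∈S)
          , (λ nC⊑S → contradiction (S , S∈P , nC⊑S) none)
          ]′ (next-comparable comp (towers S S∈P))

    comparable : ∀ {C} → Tower C → Comparable C
    comparable (succ t) r with next-comparable (comparable t) r
    ... | inj₁ R⊑C  = inj₁ λ p → ⊑-next (R⊑C p)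
    ... | inj₂ nC⊑R = inj₂ nC⊑R
    comparable (union P towers) {R} r with dec (∃ λ S → T (P S) × R ⊑ S)
    ... | yes (S , S∈P , R⊑S) = inj₁ λ p → ⌊⌋-intro (S , S∈P , R⊑S p)
    ... | no none = inj₂ λ p → let (S , S∈P , x∈S) = ⌊⌋-elim p in
          [ (λ R⊑S → contradiction (S , S∈P , R⊑S) none)
          , (λ S⊑R → S⊑R x∈S)
          ]′ (comparable (towers S S∈P) r)

    Tower⇒Clique : ∀ {S} → Tower S → Clique S
    Tower⇒Clique (succ {S} t) p q
      with ⌊⌋-elim {P = T (S _) ⊎ pick S ≡ just _} p | ⌊⌋-elim {P = T (S _) ⊎ pick S ≡ just _} q
    ... | inj₁ x∈S | inj₁ y∈S = Tower⇒Clique t x∈S y∈S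
    ... | inj₁ x∈S | inj₂ py  = ~-sym (proj₂ (pick-extends S py) x∈S)
    ... | inj₂ px  | inj₁ y∈S = proj₂ (pick-extends S px) y∈S
    ... | inj₂ px  | inj₂ py  = subst (_ ~_) (just-injective (trans (sym px) py)) ~-refl
    Tower⇒Clique (union P towers) p q with ⌊⌋-elim p | ⌊⌋-elim q
    ... | S , S∈P , x∈S | R , R∈P , y∈R with comparable (towers S S∈P) (towers R R∈P)
    ...   | inj₁ R⊑S = Tower⇒Clique (towers S S∈P) x∈S (R⊑S y∈R)
    ...   | inj₂ S⊑R = Tower⇒Clique (towers R R∈P) (S⊑R x∈S) y∈R

    abstract
      maximal : Sub
      maximal = ⋃ λ S → ⌊ Tower S ⌋

      maximal-tower : Tower maximal
      maximal-tower = union _ λ S → ⌊⌋-elim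

      maximal-clique : Clique maximal
      maximal-clique = Tower⇒Clique maximal-tower

      -- As the union of the whole tower is itself in the tower, it contains its own successor, so
      -- `pick` can find nothing to add.
      maximal-maximal : ∀ {x} → (∀ {y} → T (maximal y) → x ~ y) → T (maximal x)
      maximal-maximal {x} x~ = decidable-stable em λ x∉M →
        let (y , py) = pick-exists maximal (x∉M , x~)
        in proj₁ (pick-extends maximal py)
             (⌊⌋-intro (next maximal , ⌊⌋-intro (succ maximal-tower) , ⌊⌋-intro (inj₂ py)))

  -- A least cardinality in any nonempty family of setoids.

  module Least {I : Set c} (X : I → Setoid a ℓ) (i₀ : I) where
    private
      module X i = Setoid (X i)

    Point : Set (a ⊔ c)
    Point = ∀ i → X.Carrier i

    -- Two choice functions match if they agree everywhere or nowhere. A clique thus gives a partial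
    -- bijection between any two of the sets.
    Matching : Rel Point (c ⊔ ℓ)
    Matching f g = ∀ i j → X._≈_ i (f i) (g i) → X._≈_ j (f j) (g j)

    Matching-refl : Reflexive Matching
    Matching-refl _ j _ = X.refl j

    Matching-sym : Symmetric Matching
    Matching-sym f~g i j e = X.sym j (f~g i j (X.sym i e))

    private
      module C = MaximalClique Matching
        (λ {f} → Matching-refl {f}) (λ {f} {g} → Matching-sym {f} {g})

    Hit : ∀ i → X.Carrier i → Set (a ⊔ c ⊔ ℓ)
    Hit i x = ∃ λ f → T (C.maximal f) × X._≈_ i (f i) x

    -- If every coordinate missed a point, these points would form a choice
    -- function extending the clique.

    some-onto : ∃ λ i → ∀ x → Hit i x
    some-onto = decidable-stable em λ none →
      let missed : ∀ i → ∃ λ x → ¬ Hit i x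
          missed i = ¬∀⇒∃¬ λ onto → none (i , onto)
          m : Point
          m i = proj₁ (missed i)
          m∈ : T (C.maximal m)
          m∈ = C.maximal-maximal {m} λ {f} f∈ i j e →
                 contradiction (f , f∈ , X.sym i e) (proj₂ (missed i))
      in proj₂ (missed i₀) (m , m∈ , X.refl i₀)

    -- Every `x` in the fully hit coordinate lies on a member of the clique; its value at `j` is the
    -- image of `x`. Members that agree at one coordinate agree at all, whence well-definedness and
    -- injectivity.
    least : ∃ λ i → ∀ j → X i ≤ᶜ X j
    least = i , λ j → record
      { to        = λ x → point x j
      ; cong      = λ {x} {y} x≈y → C.maximal-clique {point x} {point y} (member x) (member y) i j
          (X.trans i (hits x) (X.trans i x≈y (X.sym i (hits y))))
      ; injective = λ {x} {y} e → X.trans i (X.sym i (hits x)) (X.trans i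
          (C.maximal-clique {point x} {point y} (member x) (member y) j i e) (hits y))
      }
      where
      i = proj₁ some-onto

      point : X.Carrier i → Point
      point x = proj₁ (proj₂ some-onto x)

      member : ∀ x → T (C.maximal (point x))
      member x = proj₁ (proj₂ (proj₂ some-onto x))

      hits : ∀ x → X._≈_ i (point x i) x
      hits x = proj₂ (proj₂ (proj₂ some-onto x))

  open Least using (least)

  ≤ᶜ-total : (A B : Setoid a ℓ) → A ≤ᶜ B ⊎ B ≤ᶜ A
  ≤ᶜ-total A B with least (λ b → if b then A else B) true
  ... | true  , A≤ = inj₁ (A≤ false)
  ... | false , B≤ = inj₂ (B≤ true)

  -- Infinite subsets of ω.

  Unbounded : Pred Subset 0ℓ
  Unbounded A = ∀ n → ∃ λ m → n ≤ m × A m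

  -- Otherwise `A` lies below `n`, and among the first `suc n` terms of its enumeration two collide
  -- by the pigeonhole principle.
  Infinite⇒Unbounded : ∀ {A} → Infinite A → Unbounded A
  Infinite⇒Unbounded {A} inf n with dec (∃ λ m → n ≤ m × A m)
  ... | yes p    = p
  ... | no  none = contradiction (Fin.toℕ-injective i≡j) (Fin.<⇒≢ i<j)
    where
    open Inverse (Bij.Bijection⇒Inverse inf)

    element<n : ∀ k → proj₁ (from k) < n
    element<n k = ≰⇒> λ n≤ → none (proj₁ (from k) , n≤ , proj₂ (from k))

    collision = Fin.pigeonhole (n<1+n n) (λ k → Fin.fromℕ< (element<n (Fin.toℕ k)))
    i   = proj₁ collision
    j   = proj₁ (proj₂ collision)
    i<j = proj₁ (proj₂ (proj₂ collision))

    i≡j : Fin.toℕ i ≡ Fin.toℕ j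
    i≡j = trans (sym (strictlyInverseˡ _)) (trans
      (to-cong (Fin.fromℕ<-injective _ _ (element<n _) (element<n _) (proj₂ (proj₂ (proj₂ collision)))))
      (strictlyInverseˡ _))

  ℕ≤ᶜ⇒Infinite : ∀ {A} → ≡.setoid ℕ ≤ᶜ subset (≡.setoid ℕ) A → Infinite A
  ℕ≤ᶜ⇒Infinite = ≤ᶜ-antisym (record { to = proj₁ ; cong = id ; injective = id })

  Unbounded⇒Infinite : ∀ {A} → Unbounded A → Infinite A
  Unbounded⇒Infinite {A} unb = ℕ≤ᶜ⇒Infinite (fresh⇒ℕ≤ᶜ (subset (≡.setoid ℕ) A) λ xs →
    let (n , xs<n) = bound xs
        (m , n≤m , m∈A) = unb n
    in (m , m∈A) , All.map (λ y<n → >⇒≢ (<-≤-trans y<n n≤m)) xs<n)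
    where
    bound : ∀ (xs : List (Σ ℕ A)) → ∃ λ n → All (λ y → proj₁ y < n) xs
    bound []       = 0 , []
    bound (x ∷ xs) =
      let (n , xs<n) = bound xs in
      suc (proj₁ x) + n , m≤m+n _ n ∷ All.map (λ y<n → ≤-trans y<n (m≤n+m n _)) xs<n

  -- Squares of infinite cardinals.

  discretise : (S : Setoid a ℓ) → ∃ λ (X : Set a) → (≡.setoid X ≤ᶜ S) × (S ≤ᶜ ≡.setoid X)
  discretise S = X , record
    { to        = proj₁
    ; cong      = λ { refl → Setoid.refl S }
    ; injective = λ {x} {y} x≈y → X-≡ (trans (sym (⌊⌋-elim (proj₂ x)))
                    (trans (canonical-cong x≈y) (⌊⌋-elim (proj₂ y))))
    } , record
    { to        = λ x → canonical x , ⌊⌋-intro (canonical-cong (Setoid.sym S (≈-canonical x)))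
    ; cong      = X-≡ ∘ canonical-cong
    ; injective = canonical-injective ∘ cong proj₁
    }
    where
    open Canonical S
    -- Each class has exactly one fixed point of `canonical`, so these form a transversal, on which
    -- `_≡_` can replace `_≈_`. The Boolean makes membership proofs unique.
    X = Σ (Setoid.Carrier S) λ x → T ⌊ canonical x ≡ x ⌋

    X-≡ : {x y : X} → proj₁ x ≡ proj₁ y → x ≡ y
    X-≡ refl = cong (_ ,_) (T-irrelevant _ _)

  module Square {X : Set a} (ℕ≤X : ≡.setoid ℕ ≤ᶜ ≡.setoid X) where
    open Injection ℕ≤X renaming (to to s; injective to s-injective) using ()

    -- An injection of the square of `Dom` into `Dom`; values of `pair` elsewhere are arbitrary. The
    -- points `s 0` and `s 1` serve as tags.
    record PartialPairing : Set a where
      field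
        Dom            : X → Bool
        s₀∈            : T (Dom (s 0))
        s₁∈            : T (Dom (s 1))
        pair           : X → X → X
        pair-closed    : ∀ {x y} → T (Dom x) → T (Dom y) → T (Dom (pair x y))
        pair-injective : ∀ {x y x′ y′} →
          T (Dom x) → T (Dom y) → T (Dom x′) → T (Dom y′) →
          pair x y ≡ pair x′ y′ → x ≡ x′ × y ≡ y′

      domain : Setoid a a
      domain = subset (≡.setoid X) (T ∘ Dom)

      codomain : Setoid a a
      codomain = subset (≡.setoid X) (∁ (T ∘ Dom))

      -- Pairing with s 0 marks the elements of the domain, with s 1 the others.

      adjoin : {Q : Pred X ℓ} →
               subset (≡.setoid X) (Q ∩ ∁ (T ∘ Dom)) ≤ᶜ domain →
               subset (≡.setoid X) Q ≤ᶜ domain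
      adjoin {Q = Q} r = record
        { to = to ; cong = λ {x} {y} → to-cong {x} {y} ; injective = λ {x} {y} → to-injective x y }
        where
        module r = Injection r
        to : Σ X Q → Σ X (T ∘ Dom)
        to (x , q) with dec (T (Dom x))
        ... | yes x∈ = pair (s 0) x , pair-closed s₀∈ x∈
        ... | no x∉  = let (y , y∈) = r.to (x , q , x∉) in pair (s 1) y , pair-closed s₁∈ y∈

        to-cong : ∀ {x y} → proj₁ x ≡ proj₁ y → proj₁ (to x) ≡ proj₁ (to y)
        to-cong {x , _} refl with dec (T (Dom x))
        ... | yes x∈ = refl
        ... | no x∉  = cong (pair (s 1)) (r.cong refl)

        s₀≢s₁ : s 0 ≢ s 1
        s₀≢s₁ eq with () ← s-injective eq

        to-injective : ∀ x y → proj₁ (to x) ≡ proj₁ (to y) → proj₁ x ≡ proj₁ y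
        to-injective (x , q) (y , q′) eq with dec (T (Dom x)) | dec (T (Dom y))
        ... | yes x∈ | yes y∈ = proj₂ (pair-injective s₀∈ x∈ s₀∈ y∈ eq)
        ... | yes x∈ | no y∉  = contradiction (proj₁ (pair-injective s₀∈ x∈ s₁∈ (proj₂ (r.to (y , q′ , y∉))) eq)) s₀≢s₁
        ... | no x∉  | yes y∈ = contradiction (sym (proj₁ (pair-injective s₁∈ (proj₂ (r.to (x , q , x∉))) s₀∈ y∈ eq))) s₀≢s₁
        ... | no x∉  | no y∉  = r.injective (proj₂ (pair-injective
          s₁∈ (proj₂ (r.to (x , q , x∉))) s₁∈ (proj₂ (r.to (y , q′ , y∉))) eq))

    open PartialPairing

    initial : PartialPairing
    initial = record
      { Dom            = λ x → ⌊ Term x ⌋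
      ; s₀∈            = ⌊⌋-intro (0 , refl)
      ; s₁∈            = ⌊⌋-intro (1 , refl)
      ; pair           = λ x y → join (dec (Term x)) (dec (Term y))
      ; pair-closed    = λ {x} {y} x∈ y∈ → join-closed (dec (Term x)) (dec (Term y)) (⌊⌋-elim x∈) (⌊⌋-elim y∈)
      ; pair-injective = λ {x} {y} {x′} {y′} x∈ y∈ x′∈ y′∈ →
          join-injective (dec (Term x)) (dec (Term y)) (dec (Term x′)) (dec (Term y′))
            (⌊⌋-elim x∈) (⌊⌋-elim y∈) (⌊⌋-elim x′∈) (⌊⌋-elim y′∈)
      }
      where
      Term : Pred X a
      Term x = ∃ λ n → s n ≡ x

      join : ∀ {x y} → Dec (Term x) → Dec (Term y) → X
      join (yes (m , _)) (yes (n , _)) = s (pairℕ m n)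
      join {x} _         _             = x

      join-closed : ∀ {x y} (dx : Dec (Term x)) (dy : Dec (Term y)) → Term x → Term y → T ⌊ Term (join dx dy) ⌋
      join-closed (yes (m , _)) (yes (n , _)) _ _ = ⌊⌋-intro (pairℕ m n , refl)
      join-closed (yes _) (no y∉) _ y∈ = contradiction y∈ y∉
      join-closed (no x∉) _       x∈ _ = contradiction x∈ x∉

      join-injective : ∀ {x y x′ y′} (dx : Dec (Term x)) (dy : Dec (Term y))
                    (dx′ : Dec (Term x′)) (dy′ : Dec (Term y′)) →
                    Term x → Term y → Term x′ → Term y′ →
                    join dx dy ≡ join dx′ dy′ → x ≡ x′ × y ≡ y′
      join-injective (no x∉) _ _ _ x∈ _ _ _ _ = contradiction x∈ x∉
      join-injective _ (no y∉) _ _ _ y∈ _ _ _ = contradiction y∈ y∉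
      join-injective _ _ (no x∉) _ _ _ x∈ _ _ = contradiction x∈ x∉
      join-injective _ _ _ (no y∉) _ _ _ y∈ _ = contradiction y∈ y∉
      join-injective (yes (m , refl)) (yes (n , refl)) (yes (m′ , refl)) (yes (n′ , refl)) _ _ _ _ eq =
        let (m≡m′ , n≡n′) = pairℕ-injective {m} {n} {m′} {n′} (s-injective eq)
        in cong s m≡m′ , cong s n≡n′

    infix 4 _≼_

    _≼_ : Rel PartialPairing a
    E ≼ F = (∀ {x} → T (Dom E x) → T (Dom F x))
          × (∀ {x y} → T (Dom E x) → T (Dom E y) → pair E x y ≡ pair F x y)

    ≼-refl : ∀ {E} → E ≼ E
    ≼-refl = id , λ _ _ → refl

    ≼-trans : ∀ {E F G} → E ≼ F → F ≼ G → E ≼ G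
    ≼-trans (E⊆F , E≡F) (F⊆G , F≡G) =
      F⊆G ∘ E⊆F , λ x∈ y∈ → trans (E≡F x∈ y∈) (F≡G (E⊆F x∈) (E⊆F y∈))

    private
      -- Cliques for comparability are chains, so this is a maximal chain in the sense of Hausdorff.
      module Chain = MaximalClique (λ E F → E ≼ F ⊎ F ≼ E)
        (λ {E} → inj₁ (≼-refl {E})) (λ {E} {F} → [ inj₂ , inj₁ ]′)

      M : Pred PartialPairing 0ℓ
      M E = T (Chain.maximal E)

      some : ∃ M
      some = decidable-stable em λ none →
        -- Were the chain empty, `initial` would vacuously be comparable with its members and so
        -- belong to it.
        none (initial , Chain.maximal-maximal λ {E} E∈ → contradiction (E , E∈) none)

      common : ∀ E F → M E → M F → ∃ λ G → M G × E ≼ G × F ≼ G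
      common E F E∈ F∈ with Chain.maximal-clique E∈ F∈
      ... | inj₁ E≼F = F , F∈ , E≼F , ≼-refl {F}
      ... | inj₂ F≼E = E , E∈ , ≼-refl {E} , F≼E

      In : X → Pred PartialPairing 0ℓ
      In x E = M E × T (Dom E x)

      common₂ : ∀ {x y} → ∃ (In x) → ∃ (In y) → ∃ λ E → M E × T (Dom E x) × T (Dom E y)
      common₂ (E , E∈ , x∈) (F , F∈ , y∈) =
        let (G , G∈ , E≼G , F≼G) = common E F E∈ F∈ in G , G∈ , proj₁ E≼G x∈ , proj₁ F≼G y∈

      ⋃pair : X → X → X
      ⋃pair x y with dec (∃ λ E → M E × T (Dom E x) × T (Dom E y))
      ... | yes (E , _) = pair E x y
      ... | no _        = x

      -- Any two members of the chain have a common extension, so the choice of the member that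
      -- supplies the value is immaterial.
      ⋃pair-≡ : ∀ E → M E → ∀ {x y} → T (Dom E x) → T (Dom E y) → ⋃pair x y ≡ pair E x y
      ⋃pair-≡ E E∈ {x} {y} x∈ y∈ with dec (∃ λ E → M E × T (Dom E x) × T (Dom E y))
      ... | no none = contradiction (E , E∈ , x∈ , y∈) none
      ... | yes (F , F∈ , x∈F , y∈F) with common E F E∈ F∈
      ...   | G , _ , E≼G , F≼G = trans (proj₂ F≼G x∈F y∈F) (sym (proj₂ E≼G x∈ y∈))

    chain-union : PartialPairing
    chain-union = record
      { Dom            = λ x → ⌊ ∃ (In x) ⌋
      ; s₀∈            = let (E , E∈) = some in ⌊⌋-intro (E , E∈ , s₀∈ E)
      ; s₁∈            = let (E , E∈) = some in ⌊⌋-intro (E , E∈ , s₁∈ E)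
      ; pair           = ⋃pair
      ; pair-closed    = λ x∈ y∈ →
          let (E , E∈ , x∈E , y∈E) = common₂ (⌊⌋-elim x∈) (⌊⌋-elim y∈)
          in ⌊⌋-intro (E , E∈ , subst (T ∘ Dom E) (sym (⋃pair-≡ E E∈ x∈E y∈E)) (pair-closed E x∈E y∈E))
      ; pair-injective = λ x∈ y∈ x′∈ y′∈ eq →
          let (E , E∈ , x∈E , y∈E)   = common₂ (⌊⌋-elim x∈) (⌊⌋-elim y∈)
              (F , F∈ , x′∈F , y′∈F) = common₂ (⌊⌋-elim x′∈) (⌊⌋-elim y′∈)
              (G , G∈ , E≼G , F≼G)   = common E F E∈ F∈
              x∈G = proj₁ E≼G x∈E ; y∈G = proj₁ E≼G y∈E
              x′∈G = proj₁ F≼G x′∈F ; y′∈G = proj₁ F≼G y′∈F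
          in pair-injective G x∈G y∈G x′∈G y′∈G
               (trans (sym (⋃pair-≡ G G∈ x∈G y∈G)) (trans eq (⋃pair-≡ G G∈ x′∈G y′∈G)))
      }

    chain-union-upper : ∀ {E} → M E → E ≼ chain-union
    chain-union-upper {E} E∈ =
      (λ x∈ → ⌊⌋-intro (E , E∈ , x∈)) , λ x∈ y∈ → sym (⋃pair-≡ E E∈ x∈ y∈)

    -- An extension of the union is comparable with every member of the chain, hence is a member
    -- itself.
    chain-union-maximal : ∀ {E} → chain-union ≼ E → E ≼ chain-union
    chain-union-maximal {E} U≼E =
      chain-union-upper {E} (Chain.maximal-maximal λ {F} F∈ →
        inj₂ (≼-trans {F} {chain-union} {E} (chain-union-upper {F} F∈) U≼E))

    -- If the complement of the domain D contains a copy h D of D, the pairing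
    -- extends to D ∪ h D by sending the new pairs into h D.

    module Enlarge (E : PartialPairing) (h : domain E ≤ᶜ codomain E) where
      private
        module h = Injection h

      Copy : Pred X a
      Copy x = ∃ λ (y : Σ X (T ∘ Dom E)) → proj₁ (h.to y) ≡ x

      Q : Pred X a
      Q x = T (Dom E x) ⊎ Copy x

      private
        retract : subset (≡.setoid X) (Q ∩ ∁ (T ∘ Dom E)) ≤ᶜ domain E
        retract = record
          { to        = λ { (x , q , x∉) → preimage q x∉ }
          ; cong      = λ { {x , q , x∉} {_ , q′ , x∉′} refl →
              h.injective (trans (preimage-≡ q x∉) (sym (preimage-≡ q′ x∉′))) }
          ; injective = λ { {x , q , x∉} {_ , q′ , x∉′} eq →
              trans (sym (preimage-≡ q x∉)) (trans (h.cong eq) (preimage-≡ q′ x∉′)) }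
          }
          where
          preimage : ∀ {x} → Q x → ¬ T (Dom E x) → Σ X (T ∘ Dom E)
          preimage (inj₁ x∈)     x∉ = contradiction x∈ x∉
          preimage (inj₂ (y , _)) _ = y

          preimage-≡ : ∀ {x} (q : Q x) (x∉ : ¬ T (Dom E x)) → proj₁ (h.to (preimage q x∉)) ≡ x
          preimage-≡ (inj₁ x∈)      x∉ = contradiction x∈ x∉
          preimage-≡ (inj₂ (_ , eq)) _ = eq

        module code = Injection (adjoin E retract)

        -- Coding `Q` into the domain, pairing the codes there and moving the result by `h` is
        -- injective, and the values avoid the domain, where all old pairs go.
        new : Σ X Q → Σ X Q → Σ X (∁ (T ∘ Dom E))
        new x y = h.to (pair E (proj₁ (code.to x)) (proj₁ (code.to y)) ,
                        pair-closed E (proj₂ (code.to x)) (proj₂ (code.to y)))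

        data Pairs (x y z : X) : Set a where
          old   : T (Dom E x) → T (Dom E y) → z ≡ pair E x y → Pairs x y z
          fresh : ¬ (T (Dom E x) × T (Dom E y)) → (qx : Q x) (qy : Q y) →
                  z ≡ proj₁ (new (x , qx) (y , qy)) → Pairs x y z

        pairs : ∀ {x y} → Q x → Q y → ∃ (Pairs x y)
        pairs {x} {y} qx qy with dec (T (Dom E x) × T (Dom E y))
        ... | yes (x∈ , y∈) = _ , old x∈ y∈ refl
        ... | no ¬old       = _ , fresh ¬old qx qy refl

        Pairs-Q : ∀ {x y z} → Pairs x y z → Q z
        Pairs-Q (old x∈ y∈ refl)       = inj₁ (pair-closed E x∈ y∈)
        Pairs-Q (fresh _ qx qy refl) = inj₂ (_ , refl)

        Pairs-injective : ∀ {x y x′ y′ z z′} → Pairs x y z → Pairs x′ y′ z′ → z ≡ z′ → x ≡ x′ × y ≡ y′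
        Pairs-injective (old x∈ y∈ refl) (old x′∈ y′∈ refl) eq = pair-injective E x∈ y∈ x′∈ y′∈ eq
        Pairs-injective (old x∈ y∈ refl) (fresh _ qx qy refl) eq =
          contradiction (subst (T ∘ Dom E) eq (pair-closed E x∈ y∈)) (proj₂ (new (_ , qx) (_ , qy)))
        Pairs-injective (fresh _ qx qy refl) (old x∈ y∈ refl) eq =
          contradiction (subst (T ∘ Dom E) (sym eq) (pair-closed E x∈ y∈)) (proj₂ (new (_ , qx) (_ , qy)))
        Pairs-injective (fresh _ qx qy refl) (fresh _ qx′ qy′ refl) eq =
          let (cx≡ , cy≡) = pair-injective E (proj₂ (code.to (_ , qx))) (proj₂ (code.to (_ , qy)))
                              (proj₂ (code.to (_ , qx′))) (proj₂ (code.to (_ , qy′))) (h.injective eq)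
          in code.injective {_ , qx} {_ , qx′} cx≡ , code.injective {_ , qy} {_ , qy′} cy≡

        extend : X → X → X
        extend x y with dec (Q x × Q y)
        ... | yes (qx , qy) = proj₁ (pairs qx qy)
        ... | no _          = x

        extend-pairs : ∀ {x y} → Q x → Q y → Pairs x y (extend x y)
        extend-pairs {x} {y} qx qy with dec (Q x × Q y)
        ... | yes (qx , qy) = proj₂ (pairs qx qy)
        ... | no ¬q         = contradiction (qx , qy) ¬q

      enlarged : PartialPairing
      enlarged = record
        { Dom            = λ x → ⌊ Q x ⌋
        ; s₀∈            = ⌊⌋-intro (inj₁ (s₀∈ E))
        ; s₁∈            = ⌊⌋-intro (inj₁ (s₁∈ E))
        ; pair           = extend
        ; pair-closed    = λ x∈ y∈ → ⌊⌋-intro (Pairs-Q (extend-pairs (⌊⌋-elim x∈) (⌊⌋-elim y∈)))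
        ; pair-injective = λ x∈ y∈ x′∈ y′∈ → Pairs-injective
            (extend-pairs (⌊⌋-elim x∈) (⌊⌋-elim y∈)) (extend-pairs (⌊⌋-elim x′∈) (⌊⌋-elim y′∈))
        }

      ≼-enlarged : E ≼ enlarged
      ≼-enlarged = (λ x∈ → ⌊⌋-intro (inj₁ x∈)) , agree
        where
        agree : ∀ {x y} → T (Dom E x) → T (Dom E y) → pair E x y ≡ extend x y
        agree x∈ y∈ with extend-pairs (inj₁ x∈) (inj₁ y∈)
        ... | old _ _ eq       = sym eq
        ... | fresh ¬old _ _ _ = contradiction (x∈ , y∈) ¬old

      enlarged-⋠ : ¬ enlarged ≼ E
      enlarged-⋠ (Q⊆ , _) = proj₂ (h.to (s 0 , s₀∈ E)) (Q⊆ (⌊⌋-intro (inj₂ (_ , refl))))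

    -- If the domain of a maximal pairing embedded in its complement, the pairing could be enlarged.
    -- So the complement embeds in the domain, and then all of `X` can be coded there by `adjoin`.
    square : ×-setoid (≡.setoid X) (≡.setoid X) ≤ᶜ ≡.setoid X
    square with ≤ᶜ-total (codomain chain-union) (domain chain-union)
    ... | inj₂ h = contradiction (chain-union-maximal {Enlarge.enlarged chain-union h} (Enlarge.≼-enlarged chain-union h))
                                 (Enlarge.enlarged-⋠ chain-union h)
    ... | inj₁ r = record
      { to        = λ (x , y) → pair chain-union (proj₁ (code.to (x , _))) (proj₁ (code.to (y , _)))
      ; cong      = λ { (refl , refl) → refl }
      ; injective = λ {(x , y)} {(x′ , y′)} eq →
          let (cx≡ , cy≡) = pair-injective chain-union
                (proj₂ (code.to (x , _))) (proj₂ (code.to (y , _)))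
                (proj₂ (code.to (x′ , _))) (proj₂ (code.to (y′ , _))) eq
          in code.injective cx≡ , code.injective cy≡
      }
      where
      outside : subset (≡.setoid X) (U ∩ ∁ (T ∘ Dom chain-union)) ≤ᶜ domain chain-union
      outside = record
        { to        = λ (x , _ , x∉) → Injection.to r (x , x∉)
        ; cong      = Injection.cong r
        ; injective = Injection.injective r
        }
      module code = Injection (adjoin chain-union {Q = U} outside)

  ×-≤ᶜ : (S : Setoid a ℓ) → ≡.setoid ℕ ≤ᶜ S → ×-setoid S S ≤ᶜ S
  ×-≤ᶜ S ℕ≤S =
    let (X , X≤S , S≤X) = discretise S
        module f = Injection S≤X
    in ≤ᶜ-trans
         (record { to        = map f.to f.to
                 ; cong      = map f.cong f.cong
                 ; injective = map f.injective f.injective })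
         (≤ᶜ-trans (Square.square (≤ᶜ-trans ℕ≤S S≤X)) X≤S)

  -- Splitting by single sets and by unions of blocks.

  Infinite-mono : ∀ {A B : Subset} → A ⊆ B → Infinite A → Infinite B
  Infinite-mono A⊆B inf = Unbounded⇒Infinite λ n →
    let (m , n≤m , m∈A) = Infinite⇒Unbounded inf n in m , n≤m , A⊆B m∈A

  ¬Infinite⇒bounded : ∀ {A : Subset} → ¬ Infinite A → ∃ λ n → ∀ m → n ≤ m → ¬ A m
  ¬Infinite⇒bounded ¬inf with ¬∀⇒∃¬ (¬inf ∘ Unbounded⇒Infinite)
  ... | n , none = n , λ m n≤m m∈A → none (m , n≤m , m∈A)

  Splits-mono : ∀ {x a b} → a ⊆ b → x Splits a → x Splits b
  Splits-mono a⊆b = map (Infinite-mono (map₂ a⊆b)) (Infinite-mono (map₂ a⊆b))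

  Splits-resp : ∀ {x y a} → x ≐ y → x Splits a → y Splits a
  Splits-resp (x⊆y , y⊆x) =
    map (Infinite-mono (map₁ x⊆y)) (Infinite-mono (map₁ (λ x∌ → x∌ ∘ y⊆x)))

  -- The terms with even index in an enumeration of `a` split `a`. This provides some splitting
  -- family, so that a minimum can be taken.
  all-splitting : SplittingFamily (λ _ → Lift (lsuc 0ℓ) ⊤)
  all-splitting a inf = x , _ ,
    ℕ≤ᶜ⇒Infinite (record
      { to        = λ k → proj₁ (e (2 * k)) , (k , refl) , proj₂ (e (2 * k))
      ; cong      = λ { refl → refl }
      ; injective = *-cancelˡ-≡ _ _ 2 ∘ e-injective }) ,
    ℕ≤ᶜ⇒Infinite (record
      { to        = λ k → proj₁ (e (suc (2 * k))) ,
                          (λ (l , eq) → even≢odd l k (e-injective eq)) , proj₂ (e (suc (2 * k)))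
      ; cong      = λ { refl → refl }
      ; injective = *-cancelˡ-≡ _ _ 2 ∘ suc-injective ∘ e-injective })
    where
    open Injection (≈ᶜ⇒≥ᶜ inf) renaming (to to e; injective to e-injective) using ()

    x : Subset
    x m = ∃ λ k → proj₁ (e (2 * k)) ≡ m

  -- Treat the sets one by one: if `x ∩ b` is finite, keep `b`; otherwise shrink to `x ∩ b`, which
  -- has no point outside `x`. Shrinking preserves being unsplit.
  unsplit : (xs : List Subset) → ∃ λ b → Infinite b × All (λ x → ¬ x Splits b) xs
  unsplit []       = U , Unbounded⇒Infinite (λ n → n , ≤-refl , _) , []
  unsplit (x ∷ xs) with unsplit xs
  ... | b , inf , ¬splits with dec (Infinite (x ∩ b))
  ...   | no ¬inf  = b , inf , ¬inf ∘ proj₁ ∷ ¬splits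
  ...   | yes inf′ = x ∩ b , inf′ ,
            (λ (_ , out) → let (_ , _ , x∌m , x∋m , _) = Infinite⇒Unbounded out 0 in x∌m x∋m) ∷
            All.map (_∘ Splits-mono proj₂) ¬splits

  -- Some infinite set is unsplit by any finitely many given members; a member splitting it differs
  -- from all of them.
  ℕ≤splitting : ∀ {F} → SplittingFamily F → ≡.setoid ℕ ≤ᶜ ∣ F ∣
  ℕ≤splitting {F} splits = fresh⇒ℕ≤ᶜ ∣ F ∣ λ xs →
    let (b , inf , ¬splits)    = unsplit (List.map proj₁ xs)
        (x , x∈F , x-splits-b) = splits b inf
    in (x , x∈F) , All.map (λ ¬y x≐y → ¬y (Splits-resp x≐y x-splits-b)) (All.map⁻ ¬splits)

  [ω,ω]⇒splitting : ∀ {F} → [ω,ω]-Splitting F → SplittingFamily F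
  [ω,ω]⇒splitting splits a inf =
    let (x , x∈F , in-inf , out-inf) = splits (λ _ → a) (λ _ → inf)
    in x , x∈F , proj₂ (proj₂ (Infinite⇒Unbounded in-inf 0))
               , proj₂ (proj₂ (Infinite⇒Unbounded out-inf 0))

  -- Given infinitely many n with e (e n) < h n, one of [n, e n) and [e n, e (e n))
  -- lies within a single block of h, so infinitely many blocks k meet a 0, …, a k.

  module BlockSplitting (a : ℕ → Subset) (a-unb : ∀ n → Unbounded (a n)) where

    e : ℕ → ℕ
    e n = suc (cumulative (λ i → proj₁ (a-unb i n)) n)

    e-meets : ∀ {i n} → i ≤ n → ∃ λ m → n ≤ m × m < e n × a i m
    e-meets {i} {n} i≤n =
      let (m , n≤m , m∈a) = a-unb i n in m , n≤m , s≤s (cumulative-upper _ i≤n) , m∈a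

    module _ (h : ℕ → ℕ) (exceeds : ∀ N → ∃ λ n → N ≤ n × e (e n) < h n) where
      open Blocks h

      Good : Subset
      Good k = ∀ {i} → i ≤ k → ∃ λ m → a i m × block m ≡ k

      Good-infinite : Infinite Good
      Good-infinite = Unbounded⇒Infinite good
        where
        good : Unbounded Good
        good N with exceeds (start N)
        ... | n , start≤n , een<hn with e n ≤? start (suc (block n))
        ...   | yes en≤ = block n , start≤⇒≤block start≤n , λ i≤k →
                  let (m , n≤m , m<en , m∈a) = e-meets (≤-trans i≤k (block≤ n))
                  in m , m∈a , block-unique (≤-trans (start-block n) n≤m) (<-≤-trans m<en en≤)
        -- The next block starts before `e n`. Its start exceeds `n`, so by monotonicity of `reach`
        -- it ends no earlier than `h n`, beyond `e (e n)`.
        ...   | no en≰ = suc (block n) , m≤n⇒m≤1+n (start≤⇒≤block start≤n) , λ i≤k →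
                  let start≤en = <⇒≤ (≰⇒> en≰)
                      (m , en≤m , m<een , m∈a) = e-meets (≤-trans i≤k (≤-trans (k≤start _) start≤en))
                      een≤ = ≤-trans (<⇒≤ een<hn)
                               (≤-trans (reach-upper n) (reach-mono (<⇒≤ (block-end n))))
                  in m , m∈a , block-unique (≤-trans start≤en en≤m) (<-≤-trans m<een een≤)

      spread : ∀ {s : Subset} → Infinite (s ∩ Good) → ∀ i → Infinite ((s ∘ block) ∩ a i)
      spread {s} inf i = Unbounded⇒Infinite λ N →
        -- That `k` is at least `N` places block `k` beyond `N`; that it is at least `i` makes the
        -- block meet `a i`.
        let (k , ≤k , k∈s , good)  = Infinite⇒Unbounded inf (N + i)
            (m , m∈a , block-m≡k) = good (≤-trans (m≤n+m i N) ≤k)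
        in m , ≤-trans (m≤m+n N i) (≤-trans ≤k (subst (_≤ m) block-m≡k (block≤ m)))
             , subst s (sym block-m≡k) k∈s , m∈a

  -- The (ω,ω)-splitting family built from thresholds.

  module Images (I : Setoid (lsuc 0ℓ) ℓ)
                (Y : Setoid.Carrier I → Subset)
                (Y-cong : ∀ {i j} → Setoid._≈_ I i j → Y i ≐ Y j) where

    image : Family
    image y = ∃ λ i → y ≐ Y i

    -- The index is read off the canonical member of each class, since equal sets may come with
    -- different indices.
    image-≤ᶜ : ∣ image ∣ ≤ᶜ I
    image-≤ᶜ = record
      { to        = index
      ; cong      = λ y≐z → Setoid.reflexive I (cong (proj₁ ∘ proj₂) (canonical-cong y≐z))
      ; injective = λ {y} {z} i≈j → canonical-≐ y z
          (≐-trans (is-image y) (≐-trans (Y-cong i≈j) (≐-sym (is-image z))))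
      }
      where
      open Canonical ∣ image ∣

      index : Σ Subset image → Setoid.Carrier I
      index y = proj₁ (proj₂ (canonical y))

      is-image : ∀ y → proj₁ (canonical y) ≐ Y (index y)
      is-image y = proj₂ (proj₂ (canonical y))

      canonical-≐ : ∀ y z → proj₁ (canonical y) ≐ proj₁ (canonical z) → proj₁ y ≐ proj₁ z
      canonical-≐ y z eq = ≐-trans (≈-canonical y) (≐-trans eq (≐-sym (≈-canonical z)))

  -- If every x ∈ F almost contains or almost misses almost every a n, the
  -- thresholds from which it does so form an unbounded family: a bound g would
  -- yield an infinite set of points of a n beyond g n, split by no x ∈ F.

  module Thresholds (F : Family) (splits : SplittingFamily F)
                    (a : ℕ → Subset) (a-inf : ∀ n → Infinite (a n))
                    (failure : ¬ ∃ λ x → x ∈ F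
                                 × Infinite (λ n → Infinite (x ∩ a n))
                                 × Infinite (λ n → Infinite (∁ x ∩ a n))) where
    open Canonical (≐-setoid ℕ 0ℓ)

    exit′ : Subset → ℕ → ℕ
    exit′ s n with dec (∃ λ k → ∀ m → k ≤ m → ¬ (s ∩ a n) m)
    ... | yes (k , _) = k
    -- Default for an infinite intersection, which has no threshold.
    ... | no _        = 0

    exit′-avoids : ∀ s n → ¬ Infinite (s ∩ a n) → ∀ m → exit′ s n ≤ m → ¬ (s ∩ a n) m
    exit′-avoids s n ¬inf with dec (∃ λ k → ∀ m → k ≤ m → ¬ (s ∩ a n) m)
    ... | yes (_ , avoids) = avoids
    ... | no none          = contradiction (¬Infinite⇒bounded ¬inf) none

    -- Evaluation at the canonical copy gives equal sets identical thresholds, so that they cut ω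
    -- into the same blocks.
    exit : Subset → ℕ → ℕ
    exit s = exit′ (canonical s)

    exit-avoids : ∀ s n → ¬ Infinite (s ∩ a n) → ∀ m → exit s n ≤ m → ¬ (s ∩ a n) m
    exit-avoids s n ¬inf m ≤m m∈ =
      exit′-avoids (canonical s) n (¬inf ∘ Infinite-mono (map₁ (proj₂ (≈-canonical s))))
        m ≤m (map₁ (proj₁ (≈-canonical s)) m∈)

    -- The sum bounds the exits of both sides, so it need not be known which side of `x` is almost
    -- always finite.
    threshold : Subset → ℕ → ℕ
    threshold x n = exit x n + exit (∁ x) n

    threshold-cong : ∀ {x y} → x ≐ y → threshold x ≡ threshold y
    threshold-cong (x⊆y , y⊆x) = cong₂ (λ s t n → exit′ s n + exit′ t n)
      (canonical-cong (x⊆y , y⊆x)) (canonical-cong ((_∘ y⊆x) , (_∘ x⊆y)))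

    Exceeds : (ℕ → ℕ) → Subset → Set
    Exceeds g x = ∀ N → ∃ λ n → N ≤ n × g n < threshold x n

    module Dominated (g : ℕ → ℕ) (dominates : ∀ {x} → x ∈ F → ¬ Exceeds g x) where

      -- The summand `n` makes the set of points infinite; `g n` puts them beyond almost all
      -- thresholds.
      point : ℕ → ℕ
      point n = proj₁ (Infinite⇒Unbounded (a-inf n) (n + g n))

      point-≥ : ∀ n → n + g n ≤ point n
      point-≥ n = proj₁ (proj₂ (Infinite⇒Unbounded (a-inf n) (n + g n)))

      point-∈ : ∀ n → a n (point n)
      point-∈ n = proj₂ (proj₂ (Infinite⇒Unbounded (a-inf n) (n + g n)))

      Points : Subset
      Points m = ∃ λ n → point n ≡ m

      Points-infinite : Infinite Points
      Points-infinite = Unbounded⇒Infinite λ n →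
        point n , ≤-trans (m≤m+n n _) (point-≥ n) , n , refl

      -- If `s ∩ a n` were finite for almost all `n`, then for large `n` the point of `a n` would
      -- lie beyond the exit of `s`, hence outside `s`.
      finite-side : ∀ {x s} → x ∈ F → (∀ n → exit s n ≤ threshold x n) →
                    Infinite (s ∩ Points) → Infinite (λ n → Infinite (s ∩ a n))
      finite-side {x} {s} x∈F exit≤ s∩P = decidable-stable em λ ¬inf →
        let (N , below)  = ¬∀⇒∃¬ (dominates x∈F)
            (N′ , ¬infs) = ¬Infinite⇒bounded ¬inf
            -- Beyond every point of index at most `N + N′`, so the index of `m` is large enough for
            -- both bounds.
            (m , bound≤m , m∈s , n , pₙ≡m) =
              Infinite⇒Unbounded s∩P (suc (cumulative point (N + N′)))
            N+N′≤n = ≮⇒≥ λ n<N+N′ → <⇒≱ bound≤m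
              (subst (_≤ _) pₙ≡m (cumulative-upper point (<⇒≤ n<N+N′)))
            threshold≤g = ≮⇒≥ λ g< → below (n , ≤-trans (m≤m+n N N′) N+N′≤n , g<)
            g≤pₙ = ≤-trans (m≤n+m (g n) n) (point-≥ n)
        in exit-avoids s n (¬infs n (≤-trans (m≤n+m N′ N) N+N′≤n)) (point n)
             (≤-trans (exit≤ n) (≤-trans threshold≤g g≤pₙ))
             (subst s (sym pₙ≡m) m∈s , point-∈ n)

      absurd : ⊥
      absurd =
        let (x , x∈F , inside , outside) = splits Points Points-infinite
        in failure (x , x∈F
             , finite-side x∈F (λ n → m≤m+n (exit x n) _) inside
             , finite-side x∈F (λ n → m≤n+m _ (exit x n)) outside)

    unbounded : ∀ g → ∃ λ x → x ∈ F × Exceeds g x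
    unbounded g = decidable-stable em λ none →
      Dominated.absurd g λ {x} x∈F ex → none (x , x∈F , ex)

    member : Σ Subset F × Σ Subset F → Subset
    member ((x , _) , (y , _)) = y ∘ Blocks.block (threshold x)

    member-cong : ∀ {p q} → Setoid._≈_ (×-setoid ∣ F ∣ ∣ F ∣) p q → member p ≐ member q
    member-cong {(x , _) , (y , _)} {_ , (y′ , _)} (x≐x′ , y⊆y′ , y′⊆y) =
      subst (λ h → (y ∘ Blocks.block (threshold x)) ≐ (y′ ∘ Blocks.block h))
        (threshold-cong x≐x′) (y⊆y′ , y′⊆y)

    open Images (×-setoid ∣ F ∣ ∣ F ∣) member (λ {p} {q} → member-cong {p} {q})
      renaming (image to blocked; image-≤ᶜ to blocked-≤ᶜ) public

    blocked-[ω,ω]-splitting : [ω,ω]-Splitting blocked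
    blocked-[ω,ω]-splitting c c-inf =
      member (p , q) , ((p , q) , ≐-refl)
      , everywhere {member (p , q)} (spread h exceeds {proj₁ q} (proj₁ y-splits))
      -- The complement of a union of blocks is the union of the remaining blocks, so `spread`
      -- applies to it as well.
      , everywhere {∁ (member (p , q))} (spread h exceeds {∁ (proj₁ q)} (proj₂ y-splits))
      where
      open BlockSplitting c (λ n → Infinite⇒Unbounded (c-inf n))

      p : Σ Subset F
      p = map₂ proj₁ (unbounded (λ n → e (e n)))

      h : ℕ → ℕ
      h = threshold (proj₁ p)

      exceeds : Exceeds (λ n → e (e n)) (proj₁ p)
      exceeds = proj₂ (proj₂ (unbounded (λ n → e (e n))))

      q : Σ Subset F
      q = map₂ proj₁ (splits (Good h exceeds) (Good-infinite h exceeds))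

      y-splits : proj₁ q Splits Good h exceeds
      y-splits = proj₂ (proj₂ (splits (Good h exceeds) (Good-infinite h exceeds)))

      everywhere : ∀ {A : Subset} → (∀ n → Infinite (A ∩ c n)) → Infinite (λ n → Infinite (A ∩ c n))
      everywhere inf = Unbounded⇒Infinite λ n → n , ≤-refl , inf n

  -- Existence and equality of the two cardinals.

  [ω,ω]-splitting-≤ : ∀ F → SplittingFamily F → ∃ λ G → [ω,ω]-Splitting G × ∣ G ∣ ≤ᶜ ∣ F ∣
  [ω,ω]-splitting-≤ F splits with dec ([ω,ω]-Splitting F)
  ... | yes splits′ = F , splits′ , Identity.injection ∣ F ∣
  ... | no ¬splits
    with a , ¬a ← ¬∀⇒∃¬ ¬splits
    with a-inf , failure ← ¬∀⇒∃¬ ¬a =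
    blocked , blocked-[ω,ω]-splitting ,
    ≤ᶜ-trans blocked-≤ᶜ (×-≤ᶜ ∣ F ∣ (ℕ≤splitting splits))
    where open Thresholds F splits a a-inf failure

  minimum : ∀ {P : Pred Family (lsuc 0ℓ)} → ∃ P → ∃ λ κ → κ IsMinCardinalityOf P
  minimum {P} inhabited =
    let ((F , F∈P) , F≤) = least {I = ∃ P} (∣_∣ ∘ proj₁) inhabited
    in ∣ F ∣ , (F , F∈P , Bij.refl) , λ G G∈P → F≤ (G , G∈P)

  ∃-𝔰 : ∃ λ κ → Is-𝔰 κ
  ∃-𝔰 = minimum (_ , all-splitting)

  ∃-𝔰[ω,ω] : ∃ λ μ → Is-𝔰[ω,ω] μ
  ∃-𝔰[ω,ω] = let (G , splits , _) = [ω,ω]-splitting-≤ _ all-splitting in minimum (G , splits)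

  𝔰≈𝔰[ω,ω] : ∀ κ μ → Is-𝔰 κ → Is-𝔰[ω,ω] μ → κ ≈ᶜ μ
  𝔰≈𝔰[ω,ω] κ μ ((F , F-splits , κ≈F) , κ≤) ((G , G-splits , μ≈G) , μ≤) =
    let (H , H-splits , H≤F) = [ω,ω]-splitting-≤ F F-splits
    in ≤ᶜ-antisym
      (≤ᶜ-trans (κ≤ G ([ω,ω]⇒splitting G-splits)) (≈ᶜ⇒≥ᶜ μ≈G))
      (≤ᶜ-trans (μ≤ H H-splits) (≤ᶜ-trans H≤F (≈ᶜ⇒≥ᶜ κ≈F)))

theorem6 : (∀ {ℓ} → ExcludedMiddle ℓ) →
    (∀ {a ℓ₁ b ℓ₂ r} → AxiomOfChoice a ℓ₁ b ℓ₂ r) →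
    (∃ λ κ → Is-𝔰 κ) ×
    (∃ λ μ → Is-𝔰[ω,ω] μ) ×
    (∀ κ μ → Is-𝔰 κ → Is-𝔰[ω,ω] μ → κ ≈ᶜ μ)
theorem6 em ac = ∃-𝔰 , ∃-𝔰[ω,ω] , 𝔰≈𝔰[ω,ω]
  where open Classical em ac
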